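{- Let $z \ge 1$ be an integer and let $n$ be an integer such that $\ell(z) \le n < \ell(z+1)$. If $n \neq 8$, then $b(n) = n^2 - zn + b(z)$.
   Context: A reachable pair of a digraph $\Gamma$ is an ordered pair $(\alpha,\beta)$ of (not necessarily distinct) vertices such that there is a directed path (possibly of length $0$) from $\alpha$ to $\beta$; the weight $w(\Gamma)$ is the number of reachable pairs. For $n\in\mathbb{N}$, $W(n)$ is the set of all integers $k$ such that some digraph on $n$ vertices has weight $k$. For $n \in \mathbb{N}$, $b(n)$ is the largest integer such that every integer $k$ with $n \le k \le b(n)$ lies in $W(n)$ (equivalently, the least integer $b(n)\ge n$ such that no digraph on $n$ vertices has exactly $b(n)+1$ reachable pairs). Define $\ell(z) := b(z) - z + 3$ for $z\in\mathbb{N}$. -}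

module Defs where

open import Data.Nat using (ℕ; suc; _+_; _≤_)
open import Data.Fin using (Fin)
open import Data.Bool using (Bool; T; if_then_else_)
open import Data.List using (map)
open import Data.Nat.ListAction using (sum)
open import Data.List.Base using (allFin)
open import Data.Product using (Σ-syntax; _×_)
open import Relation.Binary.PropositionalEquality using (_≡_)
open import Relation.Binary.Construct.Closure.ReflexiveTransitive using (Star)
open import Relation.Nullary using (¬_)
open import Function.Bundles using (_⇔_)

-- A digraph on n vertices (vertex set Fin n), given by its arc relation.
-- (Loops / multiple arcs are irrelevant for reachability.)
Digraph : ℕ → Set
Digraph n = Fin n → Fin n → Bool

Arc : ∀ {n} → Digraph n → Fin n → Fin n → Set
Arc Γ α β = T (Γ α β)

Reachable : ∀ {n} → Digraph n → Fin n → Fin n → Set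
Reachable Γ = Star (Arc Γ)

countPairs : ∀ {n} → (Fin n → Fin n → Bool) → ℕ
countPairs {n} R =
  sum (map (λ i → sum (map (λ j → if R i j then 1 else 0) (allFin n))) (allFin n))

HasWeight : ∀ {n} → Digraph n → ℕ → Set
HasWeight {n} Γ k =
  Σ[ R ∈ (Fin n → Fin n → Bool) ]
    ((∀ α β → T (R α β) ⇔ Reachable Γ α β) × countPairs R ≡ k)

InW : ℕ → ℕ → Set
InW n k = Σ[ Γ ∈ Digraph n ] HasWeight Γ k

IsB : ℕ → ℕ → Set
IsB n m = (n ≤ m) × (∀ k → n ≤ k → k ≤ m → InW n k) × ¬ InW n (suc m)

{-# OPTIONS --safe #-}
module Submission where

-- Weights are the sizes of preorders. A top cluster of size j over a preorder on n − j points gives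
-- j n + W(n − j) ⊆ W(n), and as n < ℓ(z + 1) these intervals cover everything up to n² − z n + b(z).
-- Conversely, let a preorder of weight n² − z n + b(z) + 1 have a largest cluster C, with u vertices
-- outside C of which a are incomparable to C. Shrinking C to a vertices gives a preorder on s = u + a
-- points of weight v with v + z n = s n + b(z) + 1. If s = z, then v = b(z) + 1, which is not in W(z);
-- s < z contradicts v ≥ s and ℓ(z) ≤ n. If s > z, then u (n − u) and n u / 2 bound the number of missing
-- pairs from below, which contradicts the estimate b(z) ≥ (z² + 3z − 2) / 2. That estimate fails only for
-- z = 3, where exactly n = 8 survives (48 = 4² + 4² + 4² is attained by two comparable clusters of size 4).

open import Defs
open import Data.Bool using (Bool; true; false; T; T?; _∧_; if_then_else_)
open import Data.Bool.Properties using (T-∧)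
open import Data.Empty using (⊥; ⊥-elim)
open import Data.Fin using (Fin)
open import Data.List using (List; []; _∷_; _++_; length; map; replicate; filter; tabulate; lookup; allFin)
open import Data.List.Extrema.Nat using (argmax; f[xs]≤f[argmax])
open import Data.List.Membership.Propositional using (_∈_)
open import Data.List.Membership.Propositional.Properties using (∈-allFin)
open import Data.List.Properties using (map-++; map-∘; map-cong; map-tabulate; tabulate-lookup; length-++; length-map; length-replicate; length-tabulate)
open import Data.List.Relation.Unary.All as All using (All)
open import Data.List.Relation.Unary.All.Properties using (all-filter; replicate⁺)
open import Data.List.Relation.Unary.Any using (here; there)
open import Data.Maybe using (Maybe; just; nothing)
open import Data.Nat using (ℕ; zero; suc; _+_; _*_; _∸_; _≤_; _<_; z≤n; s≤s; _≤?_; _≟_)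
open import Data.Nat.ListAction using (sum)
open import Data.Nat.ListAction.Properties using (sum-++)
open import Data.Nat.Properties
open import Data.Nat.Tactic.RingSolver using (solve-∀; solve)
open import Data.Product using (Σ-syntax; _×_; _,_; ∃-syntax)
open import Data.Sum using (inj₁; inj₂)
open import Data.Unit using (tt)
open import Function using (_∘_; id)
open import Function.Bundles using (_⇔_; mk⇔; Equivalence)
open import Relation.Binary.Construct.Closure.ReflexiveTransitive using (ε; _◅_; _◅◅_; fold)
open import Relation.Binary.Definitions using (tri<; tri≈; tri>)
open import Relation.Binary.PropositionalEquality using (_≡_; _≢_; refl; sym; trans; cong; cong₂; subst; subst₂; module ≡-Reasoning)
open import Relation.Nullary using (Dec; ¬_; yes; no; contradiction)
open import Relation.Nullary.Decidable using (from-yes)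
open import Relation.Unary using (Decidable)
open import Relation.Unary.Properties using (∁?)

private
  variable
    A B : Set

-- Sums over lists

∑ : List A → (A → ℕ) → ℕ
∑ xs h = sum (map h xs)

∑-cong : ∀ {g h : A → ℕ} → (∀ x → g x ≡ h x) → ∀ xs → ∑ xs g ≡ ∑ xs h
∑-cong eq xs = cong sum (map-cong eq xs)

∑-map : ∀ (f : A → B) (h : B → ℕ) xs → ∑ (map f xs) h ≡ ∑ xs (h ∘ f)
∑-map f h xs = cong sum (sym (map-∘ xs))

∑-++ : ∀ xs ys (h : A → ℕ) → ∑ (xs ++ ys) h ≡ ∑ xs h + ∑ ys h
∑-++ xs ys h = trans (cong sum (map-++ h xs ys)) (sum-++ (map h xs) (map h ys))

∑-+ : ∀ xs (g h : A → ℕ) → ∑ xs (λ x → g x + h x) ≡ ∑ xs g + ∑ xs h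
∑-+ [] g h = refl
∑-+ (x ∷ xs) g h = trans (cong (g x + h x +_) (∑-+ xs g h)) (interchange (g x) (h x) (∑ xs g) (∑ xs h))
  where
  interchange : ∀ a b c d → (a + b) + (c + d) ≡ (a + c) + (b + d)
  interchange = solve-∀

∑-constant : ∀ {xs} {h : A → ℕ} {c} → All (λ x → h x ≡ c) xs → ∑ xs h ≡ length xs * c
∑-constant All.[] = refl
∑-constant (px All.∷ pxs) = cong₂ _+_ px (∑-constant pxs)

∑-const : ∀ (xs : List A) c → ∑ xs (λ _ → c) ≡ length xs * c
∑-const xs c = ∑-constant (All.universal (λ _ → refl) xs)

∑-*ˡ : ∀ c xs (h : A → ℕ) → ∑ xs (λ x → c * h x) ≡ c * ∑ xs h
∑-*ˡ c [] h = sym (*-zeroʳ c)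
∑-*ˡ c (x ∷ xs) h = trans (cong (c * h x +_) (∑-*ˡ c xs h)) (sym (*-distribˡ-+ c (h x) (∑ xs h)))

∑-mono : ∀ {xs} {g h : A → ℕ} → All (λ x → g x ≤ h x) xs → ∑ xs g ≤ ∑ xs h
∑-mono All.[] = z≤n
∑-mono (px All.∷ pxs) = +-mono-≤ px (∑-mono pxs)

∑-≥-term : ∀ {x : A} {xs} (h : A → ℕ) → x ∈ xs → h x ≤ ∑ xs h
∑-≥-term h (here refl) = m≤m+n _ _
∑-≥-term h (there x∈xs) = m≤n⇒m≤o+n _ (∑-≥-term h x∈xs)

∑-swap : ∀ (xs : List A) (ys : List B) (h : A → B → ℕ) →
  ∑ xs (λ x → ∑ ys (h x)) ≡ ∑ ys (λ y → ∑ xs (λ x → h x y))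
∑-swap [] ys h = sym (trans (∑-const ys 0) (*-zeroʳ (length ys)))
∑-swap (x ∷ xs) ys h =
  trans (cong (∑ ys (h x) +_) (∑-swap xs ys h)) (sym (∑-+ ys (h x) (λ y → ∑ xs (λ x → h x y))))

∑-filter : ∀ {P : A → Set} (P? : Decidable P) xs (h : A → ℕ) →
  ∑ xs h ≡ ∑ (filter P? xs) h + ∑ (filter (∁? P?) xs) h
∑-filter P? [] h = refl
∑-filter P? (x ∷ xs) h with P? x
... | yes _ = trans (cong (h x +_) (∑-filter P? xs h)) (sym (+-assoc (h x) _ _))
... | no _ = trans (cong (h x +_) (∑-filter P? xs h)) (shift (h x) (∑ (filter P? xs) h) _)
  where
  shift : ∀ a b c → a + (b + c) ≡ b + (a + c)
  shift = solve-∀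

∑-lookup : ∀ (xs : List A) (h : A → ℕ) → ∑ (allFin (length xs)) (h ∘ lookup xs) ≡ ∑ xs h
∑-lookup xs h = begin
  ∑ (allFin (length xs)) (h ∘ lookup xs)      ≡⟨ ∑-map (lookup xs) h (allFin (length xs)) ⟨
  ∑ (map (lookup xs) (allFin (length xs))) h  ≡⟨ cong (λ ys → ∑ ys h) (map-tabulate id (lookup xs)) ⟩
  ∑ (tabulate (lookup xs)) h                  ≡⟨ cong (λ ys → ∑ ys h) (tabulate-lookup xs) ⟩
  ∑ xs h                                      ∎
  where open ≡-Reasoning

-- Weights of preorders

ind : Bool → ℕ
ind b = if b then 1 else 0

ind≤1 : ∀ b → ind b ≤ 1
ind≤1 true = ≤-refl
ind≤1 false = z≤n

ind-T : ∀ {b} → T b → ind b ≡ 1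
ind-T {true} _ = refl

ind-⇔ : ∀ {a b} → (T a → T b) → (T b → T a) → ind a ≡ ind b
ind-⇔ {true} {true} f g = refl
ind-⇔ {true} {false} f g = ⊥-elim (f tt)
ind-⇔ {false} {true} f g = ⊥-elim (g tt)
ind-⇔ {false} {false} f g = refl

ind-∧ : ∀ a b → ind a + ind b ≤ 1 + ind (a ∧ b)
ind-∧ true true = ≤-refl
ind-∧ true false = ≤-refl
ind-∧ false true = ≤-refl
ind-∧ false false = z≤n

record IsPreorder (R : A → A → Bool) : Set where
  field
    reflR : ∀ x → T (R x x)
    transR : ∀ {x y z} → T (R x y) → T (R y z) → T (R x z)

pairs : (A → A → Bool) → List A → List A → ℕ
pairs R xs ys = ∑ xs (λ x → ∑ ys (λ y → ind (R x y)))

-- Repetitions in the list produce equivalent vertices.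
InW-list : ∀ {R : A → A → Bool} → IsPreorder R → ∀ xs → InW (length xs) (pairs R xs xs)
InW-list {R = R} pre xs = Γ , Γ , (λ α β → mk⇔ (_◅ ε) (fold (λ i j → T (Γ i j)) transR (reflR _))) , count
  where
  open IsPreorder pre
  Γ : Digraph (length xs)
  Γ i j = R (lookup xs i) (lookup xs j)
  count : countPairs Γ ≡ pairs R xs xs
  count = trans
    (∑-cong (λ i → ∑-lookup xs (λ y → ind (R (lookup xs i) y))) (allFin (length xs)))
    (∑-lookup xs (λ x → ∑ xs (λ y → ind (R x y))))

InW⇒preorder : ∀ {n w} → InW n w →
  Σ[ R ∈ (Fin n → Fin n → Bool) ] IsPreorder R × pairs R (allFin n) (allFin n) ≡ w
InW⇒preorder (Γ , R , reach , count) = R , record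
  { reflR = λ x → from (reach x x) ε
  ; transR = λ p q → from (reach _ _) (to (reach _ _) p ◅◅ to (reach _ _) q)
  } , count
  where open Equivalence

length-allFin : ∀ n → length (allFin n) ≡ n
length-allFin n = length-tabulate id

n≤weight : ∀ {n w} → InW n w → n ≤ w
n≤weight {n} inW with R , pre , refl ← InW⇒preorder inW = begin
  n                            ≡⟨ trans (∑-const (allFin n) 1) (trans (*-identityʳ _) (length-allFin n)) ⟨
  ∑ (allFin n) (λ _ → 1)       ≤⟨ ∑-mono (All.universal (λ x → row x) (allFin n)) ⟩
  pairs R (allFin n) (allFin n) ∎
  where
  open ≤-Reasoning
  row : ∀ x → 1 ≤ ∑ (allFin n) (λ y → ind (R x y))
  row x = ≤-trans (≤-reflexive (sym (ind-T (IsPreorder.reflR pre x))))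
    (∑-≥-term (λ y → ind (R x y)) (∈-allFin x))

pairs-++ : ∀ (R : A → A → Bool) xs ys →
  pairs R (xs ++ ys) (xs ++ ys) ≡ (pairs R xs xs + pairs R xs ys) + (pairs R ys xs + pairs R ys ys)
pairs-++ R xs ys = trans (∑-++ xs ys _) (cong₂ _+_ (split xs) (split ys))
  where
  split : ∀ zs → pairs R zs (xs ++ ys) ≡ pairs R zs xs + pairs R zs ys
  split zs = trans (∑-cong (λ z → ∑-++ xs ys (λ y → ind (R z y))) zs) (∑-+ zs _ _)

-- Adjoining a cluster

adjoin : Bool → (A → A → Bool) → Maybe A → Maybe A → Bool
adjoin t R (just x) (just y) = R x y
adjoin t R (just x) nothing = t
adjoin t R nothing (just y) = false
adjoin t R nothing nothing = true

adjoin-isPreorder : ∀ t {R : A → A → Bool} → IsPreorder R → IsPreorder (adjoin t R)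
adjoin-isPreorder t {R} pre = record { reflR = rfl ; transR = λ {x} {y} {z} → trn x y z }
  where
  open IsPreorder pre
  rfl : ∀ x → T (adjoin t R x x)
  rfl (just x) = reflR x
  rfl nothing = tt
  trn : ∀ x y z → T (adjoin t R x y) → T (adjoin t R y z) → T (adjoin t R x z)
  trn (just x) (just y) (just z) p q = transR p q
  trn (just x) (just y) nothing p q = q
  trn (just x) nothing nothing p q = p
  trn nothing nothing nothing p q = tt

-- Listing `nothing` j times makes it a cluster of size j: all u old vertices reach it if `t` is
-- `true`, and it is a component of its own if `t` is `false`.
InW-adjoin : ∀ t j {u w} → InW u w → InW (j + u) (j * j + u * (j * ind t) + w)
InW-adjoin t j {u} inW with R , pre , refl ← InW⇒preorder inW =
  subst₂ InW length-eq weight-eq (InW-list (adjoin-isPreorder t pre) (tops ++ olds))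
  where
  S = adjoin t R
  tops = replicate j nothing
  olds = map just (allFin u)
  length-tops : length tops ≡ j
  length-tops = length-replicate j
  length-olds : length olds ≡ u
  length-olds = trans (length-map just (allFin u)) (length-allFin u)
  length-eq : length (tops ++ olds) ≡ j + u
  length-eq = trans (length-++ tops) (cong₂ _+_ length-tops length-olds)
  ∑-tops : ∀ h → ∑ tops h ≡ j * h nothing
  ∑-tops h = trans (∑-constant (replicate⁺ j refl)) (cong (_* h nothing) length-tops)
  ∑-olds : ∀ {h c} → (∀ x → h (just x) ≡ c) → ∑ olds h ≡ u * c
  ∑-olds {h} {c} eq = trans (∑-map just h (allFin u))
    (trans (∑-cong eq (allFin u)) (trans (∑-const (allFin u) c) (cong (_* c) (length-allFin u))))
  old-old : pairs S olds olds ≡ pairs R (allFin u) (allFin u)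
  old-old = trans (∑-map just _ (allFin u)) (∑-cong (λ x → ∑-map just _ (allFin u)) (allFin u))
  simplify : ∀ j u c w → (j * (j * 1) + j * (u * 0)) + (u * c + w) ≡ j * j + u * c + w
  simplify = solve-∀
  weight-eq : pairs S (tops ++ olds) (tops ++ olds) ≡ j * j + u * (j * ind t) + pairs R (allFin u) (allFin u)
  weight-eq = begin
    pairs S (tops ++ olds) (tops ++ olds)
      ≡⟨ pairs-++ S tops olds ⟩
    (pairs S tops tops + pairs S tops olds) + (pairs S olds tops + pairs S olds olds)
      ≡⟨ cong₂ _+_
           (cong₂ _+_ (trans (∑-tops _) (cong (j *_) (∑-tops _))) (trans (∑-tops _) (cong (j *_) (∑-olds (λ _ → refl)))))
           (cong₂ _+_ (∑-olds (λ _ → ∑-tops _)) old-old) ⟩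
    (j * (j * 1) + j * (u * 0)) + (u * (j * ind t) + pairs R (allFin u) (allFin u))
      ≡⟨ simplify j u (j * ind t) _ ⟩
    j * j + u * (j * ind t) + pairs R (allFin u) (allFin u) ∎
    where open ≡-Reasoning

-- Shrinking a largest cluster

clusterSize : ∀ {n} → (Fin n → Fin n → Bool) → Fin n → ℕ
clusterSize {n} R x = ∑ (allFin n) (λ y → ind (R y x ∧ R x y))

module Collapse {n} {R : Fin n → Fin n → Bool} (pre : IsPreorder R) (c : Fin n) where
  open IsPreorder pre

  _~_ : Fin n → Fin n → Set
  x ~ y = T (R x y ∧ R y x)

  ~c? : Decidable (_~ c)
  ~c? x = T? (R x c ∧ R c x)

  cluster outside : List (Fin n)
  cluster = filter ~c? (allFin n)
  outside = filter (∁? ~c?) (allFin n)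

  -- The number of outside vertices comparable to `c`, since none of them is related to `c` both
  -- ways.
  D : ℕ
  D = ∑ outside (λ x → ind (R x c) + ind (R c x))

  -- Equivalent points have the same relations to everything. The list `xs` is arbitrary so that
  -- both the cluster itself and `a` copies of `c` are covered.
  pairs-cluster : ∀ {xs} → All (_~ c) xs →
    pairs R (xs ++ outside) (xs ++ outside) ≡ length xs * length xs + length xs * D + pairs R outside outside
  pairs-cluster {xs} xs~c = begin
    pairs R (xs ++ outside) (xs ++ outside)
      ≡⟨ pairs-++ R xs outside ⟩
    (pairs R xs xs + pairs R xs outside) + (pairs R outside xs + pairs R outside outside)
      ≡⟨ cong₂ _+_
          (cong₂ _+_
            (∑-constant (All.map (λ {x} x~c → trans (row x) (trans (cong (k *_) (trans (column x~c c) (ind-T (reflR c)))) (*-identityʳ k))) xs~c))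
            (∑-constant (All.map (λ x~c → ∑-cong (λ y → column x~c y) outside) xs~c)))
          (cong (_+ _) (trans (∑-cong row outside) (∑-*ˡ k outside _))) ⟩
    (k * k + k * below) + (k * above + pairs R outside outside)
      ≡⟨ regroup k below above _ ⟩
    k * k + k * (above + below) + pairs R outside outside
      ≡⟨ cong (λ d → k * k + k * d + pairs R outside outside) (∑-+ outside _ _) ⟨
    k * k + k * D + pairs R outside outside ∎
    where
    open ≡-Reasoning
    k = length xs
    below = ∑ outside (λ y → ind (R c y))
    above = ∑ outside (λ y → ind (R y c))
    column : ∀ {x} → x ~ c → ∀ y → ind (R x y) ≡ ind (R c y)
    column x~c y with Rxc , Rcx ← Equivalence.to T-∧ x~c = ind-⇔ (transR Rcx) (transR Rxc)
    row : ∀ x → ∑ xs (λ y → ind (R x y)) ≡ k * ind (R x c)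
    row x = ∑-constant (All.map (λ y~c → let Ryc , Rcy = Equivalence.to T-∧ y~c in
      ind-⇔ (λ p → transR p Ryc) (λ p → transR p Rcy)) xs~c)
    regroup : ∀ k b a w → (k * k + k * b) + (k * a + w) ≡ k * k + k * (a + b) + w
    regroup = solve-∀

  cluster~c : All (_~ c) cluster
  cluster~c = all-filter ~c? (allFin n)

  c~c : c ~ c
  c~c = Equivalence.from T-∧ (reflR c , reflR c)

  n≡cluster+outside : n ≡ length cluster + length outside
  n≡cluster+outside = begin
    n                                             ≡⟨ length-allFin n ⟨
    length (allFin n)                             ≡⟨ count (allFin n) ⟨
    ∑ (allFin n) (λ _ → 1)                        ≡⟨ ∑-filter ~c? (allFin n) _ ⟩
    ∑ cluster (λ _ → 1) + ∑ outside (λ _ → 1)     ≡⟨ cong₂ _+_ (count cluster) (count outside) ⟩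
    length cluster + length outside               ∎
    where
    open ≡-Reasoning
    count : ∀ (xs : List (Fin n)) → ∑ xs (λ _ → 1) ≡ length xs
    count xs = trans (∑-const xs 1) (*-identityʳ _)

  cluster-size : length cluster ≡ clusterSize R c
  cluster-size = sym (begin
    ∑ (allFin n) h                            ≡⟨ ∑-filter ~c? (allFin n) h ⟩
    ∑ cluster h + ∑ outside h                 ≡⟨ cong₂ _+_ (∑-constant (All.map ind-T cluster~c)) (∑-constant (All.map ind-¬T (all-filter (∁? ~c?) (allFin n)))) ⟩
    length cluster * 1 + length outside * 0   ≡⟨ simplify (length cluster) (length outside) ⟩
    length cluster                            ∎)
    where
    open ≡-Reasoning
    h = λ y → ind (R y c ∧ R c y)
    ind-¬T : ∀ {b} → ¬ T b → ind b ≡ 0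
    ind-¬T {true} ¬b = ⊥-elim (¬b tt)
    ind-¬T {false} _ = refl
    simplify : ∀ a b → a * 1 + b * 0 ≡ a
    simplify = solve-∀

  D≤outside : D ≤ length outside
  D≤outside = ≤-trans (∑-mono (All.map bound (all-filter (∁? ~c?) (allFin n))))
    (≤-reflexive (trans (∑-const outside 1) (*-identityʳ _)))
    where
    bound : ∀ {x} → ¬ (x ~ c) → ind (R x c) + ind (R c x) ≤ 1
    bound {x} x≁c with R x c | R c x
    ... | true | true = ⊥-elim (x≁c tt)
    ... | true | false = ≤-refl
    ... | false | true = ≤-refl
    ... | false | false = z≤n

  weight-split : pairs R (allFin n) (allFin n) ≡
    length cluster * length cluster + length cluster * D + pairs R outside outside
  weight-split = trans (trans (∑-cong (λ x → split _) (allFin n)) (split _)) (pairs-cluster cluster~c)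
    where
    split : ∀ h → ∑ (allFin n) h ≡ ∑ (cluster ++ outside) h
    split h = trans (∑-filter ~c? (allFin n) h) (sym (∑-++ cluster outside h))

  InW-collapse : ∀ a → InW (a + length outside) (a * a + a * D + pairs R outside outside)
  InW-collapse a = subst₂ InW
    (trans (length-++ (replicate a c)) (cong (_+ length outside) (length-replicate a)))
    (trans (pairs-cluster (replicate⁺ a c~c)) (cong (λ k → k * k + k * D + pairs R outside outside) (length-replicate a)))
    (InW-list pre (replicate a c ++ outside))

  outside-bound : pairs R outside outside ≤ length outside * length outside
  outside-bound = ≤-trans (∑-mono (All.universal (λ x → row x) outside)) (≤-reflexive (∑-const outside _))
    where
    row : ∀ x → ∑ outside (λ y → ind (R x y)) ≤ length outside
    row x = ≤-trans (∑-mono (All.universal (λ y → ind≤1 (R x y)) outside))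
      (≤-reflexive (trans (∑-const outside 1) (*-identityʳ _)))

-- Counted in both directions, `x` and `y` contribute at most 1, or 2 if equivalent, so every row
-- sums to at most n + m.
2*weight≤ : ∀ {n} (R : Fin n → Fin n → Bool) {m} →
  (∀ x → clusterSize R x ≤ m) →
  2 * pairs R (allFin n) (allFin n) ≤ n * n + n * m
2*weight≤ {n} R {m} bound = begin
  2 * w                                        ≡⟨ cong (w +_) (+-identityʳ w) ⟩
  w + w                                        ≡⟨ cong (_+ w) (∑-swap V V (λ x y → ind (R x y))) ⟩
  ∑ V (λ x → ∑ V (λ y → ind (R y x))) + w      ≡⟨ ∑-+ V _ _ ⟨
  ∑ V (λ x → ∑ V (λ y → ind (R y x)) + ∑ V (λ y → ind (R x y)))
                                               ≤⟨ ∑-mono (All.universal row V) ⟩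
  ∑ V (λ _ → n + m)                            ≡⟨ ∑-const V _ ⟩
  length V * (n + m)                           ≡⟨ cong (_* (n + m)) (length-allFin n) ⟩
  n * (n + m)                                  ≡⟨ *-distribˡ-+ n n m ⟩
  n * n + n * m                                ∎
  where
  open ≤-Reasoning
  V = allFin n
  w = pairs R V V
  row : ∀ x → ∑ V (λ y → ind (R y x)) + ∑ V (λ y → ind (R x y)) ≤ n + m
  row x = begin
    ∑ V (λ y → ind (R y x)) + ∑ V (λ y → ind (R x y))   ≡⟨ ∑-+ V _ _ ⟨
    ∑ V (λ y → ind (R y x) + ind (R x y))               ≤⟨ ∑-mono (All.universal (λ y → ind-∧ (R y x) (R x y)) V) ⟩
    ∑ V (λ y → 1 + ind (R y x ∧ R x y))                 ≡⟨ ∑-+ V _ _ ⟩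
    ∑ V (λ _ → 1) + ∑ V (λ y → ind (R y x ∧ R x y))     ≤⟨ +-mono-≤ (≤-reflexive (trans (∑-const V 1) (trans (*-identityʳ _) (length-allFin n)))) (bound x) ⟩
    n + m                                               ∎

-- m is the size of a largest cluster, u the number of vertices outside it, and s ∸ u the number of
-- those incomparable to it; shrinking the cluster to s ∸ u vertices leaves a preorder of weight v.
record Collapsed (n w : ℕ) : Set where
  field
    m u s v : ℕ
    n≡m+u : n ≡ m + u
    u≤s : u ≤ s
    inW : InW s v
    weight : w + s * n ≡ n * n + v
    v≤u*s : v ≤ u * s
    2*w≤ : 2 * w ≤ n * n + n * m

-- Here w - v = (m - a)(m + a + D) = (m - a) n, and m - a = n - (a + u).
weight-identity : ∀ {n w u v} m a D w₀ → n ≡ m + u → a + D ≡ u →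
  w ≡ m * m + m * D + w₀ → v ≡ a * a + a * D + w₀ → w + (a + u) * n ≡ n * n + v
weight-identity m a D w₀ refl refl refl refl = solve (m ∷ a ∷ D ∷ w₀ ∷ [])

weight-bound-identity : ∀ {u} a D → a + D ≡ u → a * a + a * D + u * u ≡ u * (a + u)
weight-bound-identity a D refl = solve (a ∷ D ∷ [])

collapse-at : ∀ {n} {R : Fin n → Fin n → Bool} → IsPreorder R → ∀ c →
  (∀ x → clusterSize R x ≤ clusterSize R c) → Collapsed n (pairs R (allFin n) (allFin n))
collapse-at {n} {R} pre c largest = record
  { m = m ; u = u ; s = a + u ; v = v
  ; n≡m+u = n≡cluster+outside
  ; u≤s = m≤n+m u a
  ; inW = InW-collapse a
  ; weight = weight-eq
  ; v≤u*s = v≤us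
  ; 2*w≤ = 2*weight≤ R (λ x → ≤-trans (largest x) (≤-reflexive (sym cluster-size)))
  }
  where
  open Collapse pre c
  m = length cluster
  u = length outside
  -- The number of outside vertices incomparable to `c`; with a + D = u the shrinking costs a
  -- multiple of n.
  a = u ∸ D
  w₀ = pairs R outside outside
  v = a * a + a * D + w₀
  a+D≡u : a + D ≡ u
  a+D≡u = m∸n+n≡m D≤outside
  weight-eq : pairs R (allFin n) (allFin n) + (a + u) * n ≡ n * n + v
  weight-eq = weight-identity m a D w₀ n≡cluster+outside a+D≡u weight-split refl
  v≤us : v ≤ u * (a + u)
  v≤us = ≤-trans (+-monoʳ-≤ (a * a + a * D) outside-bound) (≤-reflexive (weight-bound-identity a D a+D≡u))

collapse : ∀ {n w} → 1 ≤ n → InW n w → Collapsed n w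
collapse {suc n} _ inW with R , pre , refl ← InW⇒preorder inW =
  -- The default `Fin.zero` of `argmax` is itself a vertex, as n ≥ 1.
  collapse-at pre (argmax (clusterSize R) Fin.zero (allFin (suc n)))
    (λ x → All.lookup (f[xs]≤f[argmax] {f = clusterSize R} Fin.zero (allFin (suc n))) (∈-allFin x))

-- Intervals of weights

Full : ℕ → ℕ → Set
Full n c = ∀ k → n ≤ k → k ≤ c → InW n k

full-isolated : ∀ {u c} → Full u c → Full (suc u) (suc c)
full-isolated {u} full (suc k) (s≤s u≤k) (s≤s k≤c) =
  subst (InW (suc u)) (cong (λ x → suc (x + k)) (*-zeroʳ u)) (InW-adjoin false 1 (full k u≤k k≤c))

full-isolated* : ∀ i {u c} → Full u c → Full (i + u) (i + c)
full-isolated* zero full = full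
full-isolated* (suc i) full = full-isolated (full-isolated* i full)

top-weight : ∀ j y w → j * j + y * (j * 1) + w ≡ j * (j + y) + w
top-weight = solve-∀

-- A top cluster of size j over y points of weight w gives j n + w, as j² + y j = j n. These weights
-- fill [j n + y, j n + d], which by the last inequality starts at c + 1 or earlier.
full-glue : ∀ j {n y c d} → n ≡ j + y → Full n c → Full y d → j * n + y ≤ suc c → Full n (j * n + d)
full-glue j {n} {y} {c} {d} refl full-n full-y gap k n≤k k≤ with k ≤? c
... | yes k≤c = full-n k n≤k k≤c
... | no k≰c with e , refl ← m≤n⇒∃[o]m+o≡n (≤-trans gap (≰⇒> k≰c)) =
  subst (InW n) (trans (top-weight j y (y + e)) (sym (+-assoc (j * n) y e)))
    (InW-adjoin true j (full-y (y + e) (m≤m+n y e) (+-cancelˡ-≤ (j * n) _ _ (subst (_≤ j * n + d) (+-assoc (j * n) y e) k≤))))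

-- An isolated vertex gives the weights up to c + 1, a single top vertex those from 2u + 1 to u + 1
-- + c.
full-suc : ∀ {u c} → Full u c → 2 * u ≤ suc c → Full (suc u) (suc u + c)
full-suc {u} {c} full gap = subst (λ x → Full (suc u) (x + c)) (*-identityˡ (suc u))
  (full-glue 1 refl (full-isolated full) full (subst (_≤ suc (suc c)) (rearrange u) (s≤s gap)))
  where
  rearrange : ∀ u → suc (2 * u) ≡ 1 * suc u + u
  rearrange = solve-∀

IsB⇒≥ : ∀ {n b c} → IsB n b → Full n c → c ≤ b
IsB⇒≥ {b = b} (n≤b , _ , ¬inW) full = ≮⇒≥ (λ b<c → ¬inW (full (suc b) (m≤n⇒m≤1+n n≤b) b<c))

IsB-unique : ∀ {n b c} → IsB n b → Full n c → ¬ InW n (suc c) → n ≤ suc c → b ≡ c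
IsB-unique {b = b} {c} isB@(_ , full , _) full-c ¬inW n≤ =
  ≤-antisym (≮⇒≥ (λ c<b → ¬inW (full (suc c) n≤ c<b))) (IsB⇒≥ isB full-c)

-- Abstract, so that the type checker never evaluates the ring-solver proofs passed to these lemmas.
abstract
  -- Certificates for polynomial inequalities: a ≤ b is a weighted sum of hypotheses and `x` is the
  -- nonnegative slack. In `cancel-≤`, `e` is the summand common to both sides.
  absurd-≤ : ∀ {a b} x → a ≤ b → a ≡ suc (b + x) → ⊥
  absurd-≤ {b = b} x a≤b refl = <-irrefl refl (≤-trans (s≤s (m≤m+n b x)) a≤b)

  cancel-≤ : ∀ {a b c d} e x → a ≤ b → a ≡ c + x + e → b ≡ d + e → c ≤ d
  cancel-≤ {c = c} {d} e x a≤b refl refl = ≤-trans (m≤m+n c x) (+-cancelʳ-≤ e _ _ a≤b)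

infixl 6 _⊕_
infixl 7 _⊛_

-- Copies of +-mono-≤ and *-monoʳ-≤ whose types are syntactically polynomial, as the ring solver needs.
_⊕_ : ∀ {a b c d} → a ≤ b → c ≤ d → a + c ≤ b + d
_⊕_ = +-mono-≤

_⊛_ : ∀ k {a b} → a ≤ b → k * a ≤ k * b
k ⊛ a≤b = *-monoʳ-≤ k a≤b

-- A quadratic lower bound for b

full-0 : Full 0 0
full-0 zero _ _ = InW-list {A = Fin 0} {R = λ _ _ → true} (record { reflR = λ _ → tt ; transR = λ _ _ → tt }) []

full-1 : Full 1 1
full-1 = full-isolated full-0

full-2 : Full 2 4
full-2 = full-glue 2 refl (full-suc full-1 (from-yes (2 ≤? 2))) full-0 (from-yes (4 ≤? 4))

full-3 : Full 3 7
full-3 = full-suc full-2 (from-yes (4 ≤? 5))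

-- Top clusters of sizes 1, 2, 3 extend the interval in turn to 11, 12, 13.
full-4 : Full 4 13
full-4 = full-glue 3 refl
  (full-glue 2 refl (full-suc full-3 (from-yes (6 ≤? 8))) full-2 (from-yes (10 ≤? 12)))
  full-1 (from-yes (13 ≤? 13))

full-5 : Full 5 19
full-5 = full-glue 3 refl (full-suc full-4 (from-yes (8 ≤? 14))) full-2 (from-yes (17 ≤? 19))

full-6 : Full 6 28
full-6 = full-glue 4 refl (full-suc full-5 (from-yes (10 ≤? 20))) full-2 (from-yes (26 ≤? 26))

-- The last bound is c ≥ (u² + 3u - 2) / 2. Of the linear ones, 2u ≤ c + 1 is the gap of `full-suc`
-- and u + 2 ≤ c supplies the later gaps of the induction.
Large : ℕ → Set
Large u = ∃[ c ] Full u c × 2 * u ≤ suc c × u + 2 ≤ c × u * u + 3 * u ≤ 2 * c + 2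

large-gaps : ∀ {u c} → u + 2 ≤ c →
  2 * suc u ≤ suc (suc u + c) ×
  2 * (2 + u) ≤ suc (2 + u + (1 + u + c)) ×
  3 * (3 + u) + u ≤ suc (3 + u + (2 + u + (1 + u + c)))
large-gaps {u} h with k , refl ← m≤n⇒∃[o]m+o≡n h =
  cancel-≤ 0 (2 + k) ≤-refl (first u k) (sym (+-identityʳ _)) ,
  cancel-≤ 0 (2 + u + k) ≤-refl (second u k) (sym (+-identityʳ _)) ,
  cancel-≤ 0 k ≤-refl (third u k) (sym (+-identityʳ _))
  where
  first : ∀ u k → suc (suc u + (u + 2 + k)) ≡ 2 * suc u + (2 + k) + 0
  first = solve-∀
  second : ∀ u k → suc (2 + u + (1 + u + (u + 2 + k))) ≡ 2 * (2 + u) + (2 + u + k) + 0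
  second = solve-∀
  third : ∀ u k → suc (3 + u + (2 + u + (1 + u + (u + 2 + k)))) ≡ 3 * (3 + u) + u + k + 0
  third = solve-∀

large-bounds : ∀ {u c} → 2 * u ≤ suc c → u + 2 ≤ c → u * u + 3 * u ≤ 2 * c + 2 →
  2 * (3 + u) ≤ suc (3 * (3 + u) + c) ×
  (3 + u) + 2 ≤ 3 * (3 + u) + c ×
  (3 + u) * (3 + u) + 3 * (3 + u) ≤ 2 * (3 * (3 + u) + c) + 2
large-bounds {u} {c} h₁ h₂ h₃ =
  cancel-≤ 0 (3 + 3 * u) (≤-refl {3 * (3 + u)} ⊕ h₁) (solve (u ∷ [])) (solve (u ∷ c ∷ [])) ,
  cancel-≤ 0 (6 + 3 * u) (≤-refl {3 * (3 + u)} ⊕ h₂) (solve (u ∷ [])) (solve (u ∷ c ∷ [])) ,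
  cancel-≤ 0 0 (≤-refl {6 * (3 + u)} ⊕ h₃) (solve (u ∷ [])) (solve (u ∷ c ∷ []))

-- The increment of (u² + 3u − 2) / 2 from u to 3 + u is exactly the 3u + 9 gained from a top cluster of size 3.
large-+3 : ∀ {u} → Large u → Large (3 + u)
large-+3 {u} (c , full , 2u≤ , u+2≤ , quadratic) =
  let gap₂ , gap₃ , gap = large-gaps u+2≤ in
  3 * (3 + u) + c ,
  full-glue 3 refl (full-suc (full-suc (full-suc full 2u≤) gap₂) gap₃) full gap ,
  large-bounds 2u≤ u+2≤ quadratic

large : ∀ i → Large (4 + i)
large 0 = 13 , full-4 , from-yes (8 ≤? 14) , from-yes (6 ≤? 13) , from-yes (28 ≤? 28)
large 1 = 19 , full-5 , from-yes (10 ≤? 20) , from-yes (7 ≤? 19) , from-yes (40 ≤? 40)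
large 2 = 28 , full-6 , from-yes (12 ≤? 29) , from-yes (8 ≤? 28) , from-yes (54 ≤? 58)
large (suc (suc (suc i))) = large-+3 (large i)

quadratic-bound : ∀ {z b} → 1 ≤ z → z ≢ 3 → IsB z b → z * z + 3 * z ≤ 2 * b + 2
quadratic-bound {z} {b} 1≤z z≢3 isB =
  let c , full , h = witness z 1≤z z≢3 in ≤-trans h (+-monoˡ-≤ 2 (*-monoʳ-≤ 2 (IsB⇒≥ isB full)))
  where
  witness : ∀ z → 1 ≤ z → z ≢ 3 → ∃[ c ] Full z c × z * z + 3 * z ≤ 2 * c + 2
  witness 1 _ _ = 1 , full-1 , from-yes (4 ≤? 4)
  witness 2 _ _ = 4 , full-2 , from-yes (10 ≤? 10)
  witness 3 _ z≢3 = contradiction refl z≢3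
  witness (suc (suc (suc (suc i)))) _ _ with c , full , _ , _ , h ← large i = c , full , h

-- The weaker constant 4 admits z = 3, where `full-3` gives 18 = 2 · 7 + 4.
quadratic-bound′ : ∀ {z b} → 1 ≤ z → IsB z b → z * z + 3 * z ≤ 2 * b + 4
quadratic-bound′ {z} {b} 1≤z isB with z ≟ 3
... | yes refl = +-monoˡ-≤ 4 (*-monoʳ-≤ 2 (IsB⇒≥ isB full-3))
... | no z≢3 = ≤-trans (quadratic-bound 1≤z z≢3 isB) (+-monoʳ-≤ (2 * b) (from-yes (2 ≤? 4)))

-- The weight n² − zn + b(z) + 1 is not attained

-- With z = s + d + 1 the equation reads v + (d + 1) n = b + 1, and v ≥ s, n ≥ 1 give n + z ≤ b + 2.
s<z-absurd : ∀ {s v n b} d → 1 ≤ n → s ≤ v → v + (s + suc d) * n ≡ s * n + suc b → b + 3 ≤ n + (s + suc d) → ⊥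
s<z-absurd {s} {v} {n} {b} d 1≤n s≤v eq b≤ = absurd-≤ 0
  (subst (s + d * 1 + (b + 3) ≤_) sum-eq (s≤v ⊕ d ⊛ 1≤n ⊕ b≤))
  (solve (s ∷ d ∷ b ∷ []))
  where
  drop : ∀ v s d n → v + (n + d * n) + s * n ≡ v + (s + suc d) * n
  drop = solve-∀
  regroup : ∀ v n d s → (v + d * n) + (n + (s + suc d)) ≡ (v + (n + d * n)) + (s + suc d)
  regroup = solve-∀
  cancelled : v + (n + d * n) ≡ suc b
  cancelled = +-cancelʳ-≡ (s * n) _ _ (trans (drop v s d n) (trans eq (+-comm (s * n) (suc b))))
  sum-eq : (v + d * n) + (n + (s + suc d)) ≡ suc b + (s + suc d)
  sum-eq = trans (regroup v n d s) (cong (_+ (s + suc d)) cancelled)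

missing-bound : ∀ m u s z v b → v ≤ u * s → v + z * (m + u) ≡ s * (m + u) + suc b →
  s * m + suc b ≤ z * (m + u)
missing-bound m u s z v b v≤ eq = cancel-≤ (u * s) 0 (v≤ ⊕ ≤-refl {z * (m + u)})
  (trans eq (solve (m ∷ u ∷ s ∷ b ∷ []))) (+-comm (u * s) (z * (m + u)))

-- With z = p + 1, the bounds give m + b + 1 ≤ z u ≤ z² and m ≥ b + 3 - 2z, so 2b + 4 ≤ z² + 2z,
-- which is less than z² + 3z.
u≤z-absurd : ∀ m u s p b → u ≤ suc p → suc (suc p) ≤ s → s * m + suc b ≤ suc p * (m + u) →
  b + 3 ≤ (m + u) + suc p → suc p * suc p + 3 * suc p ≤ 2 * b + 4 → ⊥
u≤z-absurd m u s p b u≤z z<s missing b≤ quadratic = absurd-≤ p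
  (m ⊛ z<s ⊕ missing ⊕ suc p ⊛ u≤z ⊕ u≤z ⊕ b≤ ⊕ quadratic)
  (solve (m ∷ u ∷ s ∷ p ∷ b ∷ []))

-- At least n u / 2 of the n² pairs are missing, where n = m + u, while exactly z n - b - 1 are.
comparable-bound : ∀ m u z w b → 2 * w ≤ (m + u) * (m + u) + (m + u) * m →
  w + z * (m + u) ≡ (m + u) * (m + u) + suc b → (m + u) * u + 2 * suc b ≤ 2 * (z * (m + u))
comparable-bound m u z w b 2w≤ eq = cancel-≤ ((m + u) * (m + u) + (m + u) * m) 0
  (2w≤ ⊕ ≤-refl {2 * (z * (m + u))})
  (trans (sym (*-distribˡ-+ 2 w (z * (m + u)))) (trans (cong (2 *_) eq) (split m u b)))
  (+-comm _ (2 * (z * (m + u))))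
  where
  split : ∀ m u b → 2 * ((m + u) * (m + u) + suc b) ≡
    (m + u) * u + 2 * suc b + 0 + ((m + u) * (m + u) + (m + u) * m)
  split = solve-∀

u≥2z-absurd : ∀ n u z b → n * u + 2 * suc b ≤ 2 * (z * n) → 2 * z ≤ u → ⊥
u≥2z-absurd n u z b h 2z≤u = absurd-≤ (2 * b + 1) (n ⊛ 2z≤u ⊕ h) (solve (n ∷ u ∷ z ∷ b ∷ []))

-- For u = z + t, adding 2t times the bound on b + 3, twice `missing` and t + 1 times `quadratic`
-- yields (t - 1) z (z - 3) ≤ 2t (t - 2). For t = 1 this is 0 ≤ -2; the certificate is halved here.
t=1-absurd : ∀ m z b → (z + 1) * m + suc b ≤ z * (m + (z + 1)) → b + 3 ≤ m + (z + 1) + z →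
  z * z + 3 * z ≤ 2 * b + 2 → ⊥
t=1-absurd m z b missing b≤ quadratic = absurd-≤ 0 (missing ⊕ b≤ ⊕ quadratic)
  (solve (m ∷ z ∷ b ∷ []))

-- The combined inequality becomes z (z - 3) ≤ 0, false for z ≥ 4.
t=2-absurd : ∀ m r b → let z = 4 + r; t = 2 in
  (z + t) * m + suc b ≤ z * (m + (z + t)) → b + 3 ≤ m + (z + t) + z → z * z + 3 * z ≤ 2 * b + 2 → ⊥
t=2-absurd m r b missing b≤ quadratic = absurd-≤ (3 + 5 * r + r * r) 
  (4 ⊛ b≤ ⊕ 2 ⊛ missing ⊕ 3 ⊛ quadratic) (solve (m ∷ r ∷ b ∷ []))

-- As z ≥ t + 1, the left side is at least (t - 1)(t + 1)(t - 2), and t² - 1 > 2t.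
t≥3-absurd : ∀ m q r b → let t = 3 + q; z = suc t + r in
  (z + t) * m + suc b ≤ z * (m + (z + t)) → b + 3 ≤ m + (z + t) + z → z * z + 3 * z ≤ 2 * b + 2 → ⊥
t≥3-absurd m q r b missing b≤ quadratic = absurd-≤
  (1 + 6 * q + 10 * r + 5 * (q * q) + 9 * (q * r) + 2 * (r * r) + q * q * q + 2 * (q * q * r) + q * r * r)
  ((2 * (3 + q)) ⊛ b≤ ⊕ 2 ⊛ missing ⊕ (4 + q) ⊛ quadratic)
  (solve (m ∷ q ∷ r ∷ b ∷ []))

z<u-absurd : ∀ m z t r b → z ≡ suc (suc t) + r → z ≢ 3 → (z + suc t) * m + suc b ≤ z * (m + (z + suc t)) →
  b + 3 ≤ m + (z + suc t) + z → z * z + 3 * z ≤ 2 * b + 2 → ⊥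
z<u-absurd m z zero r b _ _ = t=1-absurd m z b
z<u-absurd m z (suc zero) zero b refl z≢3 = contradiction refl z≢3
z<u-absurd m z (suc zero) (suc r) b refl _ = t=2-absurd m r b
z<u-absurd m z (suc (suc q)) r b refl _ = t≥3-absurd m q r b

-- The two bounds give m ≤ 11 - b ≤ 4 and m ≥ b - 3 ≥ 4.
z=3-u=4 : ∀ m b → 4 * m + suc b ≤ 3 * (m + 4) → (m + 4) * 4 + 2 * suc b ≤ 2 * (3 * (m + 4)) → 7 ≤ b → m + 4 ≡ 8
z=3-u=4 m b missing comparable 7≤b = cong (_+ 4) (≤-antisym
  (cancel-≤ (3 * m + b + 8) 0 (missing ⊕ 7≤b) (solve (m ∷ b ∷ [])) (solve (m ∷ b ∷ [])))
  (*-cancelˡ-≤ 2 (cancel-≤ (4 * m + 24 + 2 * b) 0 (comparable ⊕ 2 ⊛ 7≤b) (solve (m ∷ b ∷ [])) (solve (m ∷ b ∷ [])))))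

-- The two bounds give 2m ≤ 14 - b and m ≥ 2b - 3, hence b ≤ 4.
z=3-u=5 : ∀ m b → 5 * m + suc b ≤ 3 * (m + 5) → (m + 5) * 5 + 2 * suc b ≤ 2 * (3 * (m + 5)) → 7 ≤ b → ⊥
z=3-u=5 m b missing comparable 7≤b = absurd-≤ 14 
  (missing ⊕ 2 ⊛ comparable ⊕ 5 ⊛ 7≤b) (solve (m ∷ b ∷ []))

z=3-absurd : ∀ m u b → 3 < u → u < 6 → m + u ≢ 8 → u * m + suc b ≤ 3 * (m + u) →
  (m + u) * u + 2 * suc b ≤ 2 * (3 * (m + u)) → 7 ≤ b → ⊥
z=3-absurd m u b 3<u (s≤s u≤5) n≢8 missing comparable 7≤b with m≤n⇒m<n∨m≡n u≤5
... | inj₂ refl = z=3-u=5 m b missing comparable 7≤b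
... | inj₁ (s≤s u≤4) with refl ← ≤-antisym u≤4 3<u = n≢8 (z=3-u=4 m b missing comparable 7≤b)

s>z-absurd : ∀ {z b m u s} → 1 ≤ z → IsB z b → m + u ≢ 8 → b + 3 ≤ m + u + z → u ≤ s → z < s →
  s * m + suc b ≤ z * (m + u) → (m + u) * u + 2 * suc b ≤ 2 * (z * (m + u)) → ⊥
s>z-absurd {z@(suc p)} {b} {m} {u} {s} 1≤z isB n≢8 b≤ u≤s z<s missing comparable with u ≤? z
... | yes u≤z = u≤z-absurd m u s p b u≤z z<s missing b≤ (quadratic-bound′ 1≤z isB)
... | no u≰z with t , eq ← m≤n⇒∃[o]m+o≡n (≰⇒> u≰z) = large-u t (trans (sym eq) (sym (+-suc z t)))
  where
  large-u : ∀ t → u ≡ z + suc t → ⊥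
  large-u t refl = cases (z ≟ 3)
    where
    -- Once u > z, the value of `s` can be lowered to `u`.
    missing′ : u * m + suc b ≤ z * (m + u)
    missing′ = ≤-trans (+-monoˡ-≤ (suc b) (*-monoˡ-≤ m u≤s)) missing
    u<2z : u < 2 * z
    u<2z = ≰⇒> (u≥2z-absurd (m + u) u z b comparable)
    suc-t<z : suc t < z
    suc-t<z = +-cancelˡ-< z (suc t) z (subst (z + suc t <_) (cong (z +_) (+-identityʳ z)) u<2z)
    cases : Dec (z ≡ 3) → ⊥
    cases (yes refl) = z=3-absurd m u b (≰⇒> u≰z) u<2z n≢8 missing′ comparable (IsB⇒≥ isB full-3)
    cases (no z≢3) = let r , eq = m≤n⇒∃[o]m+o≡n suc-t<z in
      z<u-absurd m z t r b (sym eq) z≢3 missing′ b≤ (quadratic-bound 1≤z z≢3 isB)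

weights-cancel : ∀ q r t {w v c} → w + r ≡ q + v → w + t ≡ q + c → v + t ≡ r + c
weights-cancel q r t {w} {v} {c} eq₁ eq₂ = +-cancelˡ-≡ q _ _ (begin
  q + (v + t)   ≡⟨ +-assoc q v t ⟨
  (q + v) + t   ≡⟨ cong (_+ t) eq₁ ⟨
  (w + r) + t   ≡⟨ swap w r t ⟩
  (w + t) + r   ≡⟨ cong (_+ r) eq₂ ⟩
  (q + c) + r   ≡⟨ swap′ q c r ⟩
  q + (r + c)   ∎)
  where
  open ≡-Reasoning
  swap : ∀ a b c → (a + b) + c ≡ (a + c) + b
  swap = solve-∀
  swap′ : ∀ a b c → (a + b) + c ≡ a + (c + b)
  swap′ = solve-∀

not-attained : ∀ {z n b w} → 1 ≤ z → IsB z b → 1 ≤ n → n ≢ 8 → b + 3 ≤ n + z →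
  w + z * n ≡ n * n + suc b → ¬ InW n w
not-attained {z} {n} {b} {w} 1≤z isB@(_ , _ , ¬inW) 1≤n n≢8 b≤ w-eq inW-w
  with record { m = m ; u = u ; s = s ; v = v ; n≡m+u = refl ; u≤s = u≤s ; inW = inW-v ; weight = weight
              ; v≤u*s = v≤u*s ; 2*w≤ = 2*w≤ } ← collapse 1≤n inW-w
  -- Eliminating `w` leaves v + z n = s n + b + 1.
  with v-eq ← weights-cancel (n * n) (s * n) (z * n) weight w-eq
  with <-cmp s z
... | tri< s<z _ _ with d , refl ← m≤n⇒∃[o]m+o≡n s<z =
  s<z-absurd d 1≤n (n≤weight inW-v)
    (subst (λ x → v + x * (m + u) ≡ s * (m + u) + suc b) (sym (+-suc s d)) v-eq)
    (subst (λ x → b + 3 ≤ m + u + x) (sym (+-suc s d)) b≤)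
... | tri≈ _ refl _ = ¬inW (subst (InW s) (+-cancelʳ-≡ (s * n) _ _ (trans v-eq (+-comm (s * n) (suc b)))) inW-v)
... | tri> _ _ z<s = s>z-absurd 1≤z isB n≢8 b≤ u≤s z<s
  (missing-bound m u s z v b v≤u*s v-eq) (comparable-bound m u z w b 2*w≤ w-eq)

-- Every smaller weight is attained

-- With z = p + 1, n ≤ z would give 2b + 6 ≤ 4z and so z² + 3z + 2 ≤ 4z.
n≤z-absurd : ∀ n p b → suc p * suc p + 3 * suc p ≤ 2 * b + 4 → b + 3 ≤ n + suc p → n ≤ suc p → ⊥
n≤z-absurd n p b quadratic b≤ n≤z = absurd-≤ (p * p + p + 1) (quadratic ⊕ 2 ⊛ b≤ ⊕ 2 ⊛ n≤z)
  (solve (n ∷ p ∷ b ∷ []))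

z<n-from-bound : ∀ {z n b} → 1 ≤ z → IsB z b → b + 3 ≤ n + z → z < n
z<n-from-bound {suc p} {n} {b} 1≤z isB b≤ = ≰⇒> (n≤z-absurd n p b (quadratic-bound′ 1≤z isB) b≤)

-- Adding y - x isolated vertices shifts the interval and keeps its length.
full-above : ∀ {x e} → Full x (x + e) → ∀ y → x ≤ y → Full y (y + e)
full-above {x} {e} full y x≤y = subst (λ y → Full y (y + e)) (m∸n+n≡m x≤y)
  (subst (Full (y ∸ x + x)) (sym (+-assoc (y ∸ x) x e)) (full-isolated* (y ∸ x) full))

step-gap : ∀ n q y e → n ≤ e + 2 → (n + q) + y ≤ suc (q + (suc y + e))
step-gap n q y e n≤ = cancel-≤ 0 0 (n≤ ⊕ ≤-refl {q + y}) (solve (n ∷ q ∷ y ∷ [])) (solve (q ∷ y ∷ e ∷ []))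

-- The weights with a top cluster of size j on W(y), y = n ∸ j, fill [j n + y, j n + y + e]; as n ≤ e + 2
-- these intervals overlap or abut.
staircase : ∀ {x e n} → n ≤ e + 2 → (∀ y → x ≤ y → Full y (y + e)) →
  ∀ j y → x ≤ y → n ≡ j + y → Full n (j * n + (y + e))
staircase n≤ full zero y x≤y refl = full y x≤y
staircase {x} {e} {n} n≤ full (suc j) y x≤y eq =
  full-glue (suc j) eq (staircase n≤ full j (suc y) (m≤n⇒m≤1+n x≤y) (trans eq (sym (+-suc j y))))
    (full y x≤y) (step-gap n (j * n) y e n≤)

ℓ-lower : ∀ z {b n} → z ≤ b → b ∸ z + 3 ≤ n → b + 3 ≤ n + z
ℓ-lower z {b} {n} z≤b h with e , refl ← m≤n⇒∃[o]m+o≡n z≤b = begin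
  z + e + 3             ≡⟨ +-assoc z e 3 ⟩
  z + (e + 3)           ≡⟨ cong (λ x → z + (x + 3)) (m+n∸m≡n z e) ⟨
  z + (z + e ∸ z + 3)   ≤⟨ +-monoʳ-≤ z h ⟩
  z + n                 ≡⟨ +-comm z n ⟩
  n + z                 ∎
  where open ≤-Reasoning

-- Here z + e stands for b(z), so that ℓ(z) = e + 3.
ℓ-upper : ∀ z {e n} → n < z + e ∸ z + 3 → n ≤ e + 2
ℓ-upper z {e} {n} h = +-cancelˡ-≤ 1 n (e + 2)
  (≤-trans (subst (λ x → n < x + 3) (m+n∸m≡n z e) h) (≤-reflexive (+-suc e 2)))

weight-total : ∀ z j b → let n = suc z + j in (suc j * n + b) + z * n ≡ n * n + b
weight-total = solve-∀

theorem1p4 : ∀ (z n bz bz₁ bn : ℕ) → 1 ≤ z →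
    IsB z bz → IsB (suc z) bz₁ → IsB n bn →
    bz ∸ z + 3 ≤ n → n < bz₁ ∸ suc z + 3 →
    n ≢ 8 →
    bn + z * n ≡ n * n + bz
theorem1p4 z n bz bz₁ bn 1≤z isB-z@(z≤bz , full-z , _) (z₁≤bz₁ , full-z₁ , _) isB-n ℓz≤n n<ℓz₁ n≢8
  with e , refl ← m≤n⇒∃[o]m+o≡n z₁≤bz₁
  with b≤ ← ℓ-lower z z≤bz ℓz≤n
  with j , refl ← m≤n⇒∃[o]m+o≡n (z<n-from-bound 1≤z isB-z b≤)
  = trans (cong (_+ z * n) bn≡) (weight-total z j bz)
  where
  n≤ : n ≤ e + 2
  n≤ = ℓ-upper (suc z) n<ℓz₁
  c = suc j * n + bz
  full : Full n c
  -- The staircase stops at a top cluster of size j = n - z - 1 over z + 1 points; one of size n - z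
  -- over z points then reaches (n - z) n + b(z).
  full = full-glue (suc j) (cong suc (+-comm z j))
    (staircase n≤ (full-above full-z₁) j (suc z) ≤-refl (+-comm (suc z) j))
    full-z (step-gap n (j * n) z e n≤)
  bn≡ : bn ≡ c
  bn≡ = IsB-unique isB-n full
    (not-attained 1≤z isB-z (s≤s z≤n) n≢8 b≤ (trans (cong suc (weight-total z j bz)) (sym (+-suc (n * n) bz))))
    (m≤n⇒m≤1+n (≤-trans (m≤m+n n (j * n)) (m≤m+n (suc j * n) bz)))
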